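{- Let $q$ be a prime power and let $n,r\ge 1$ be integers. The number of $n$-restricted $q$-set partitions of $\{1,\ldots,r\}$ is $$|\mathcal{P}_{n\times r}(q)|=\sum_{\ell=1}^n S(r,\ell)\,[n][n-1]\cdots[n-\ell+1].$$
   Context: $[i]=\frac{q^i-1}{q-1}$ for integers $i\ge0$, and $S(r,\ell)$ is the Stirling number of the second kind (the number of set partitions of an $r$-element set into $\ell$ nonempty subsets). $\mathbb{Z}_n^r=\{(k_1,\ldots,k_r)\in\mathbb{Z}^r\mid 0\le k_1,\ldots,k_r\le n-1\}$. For $k\in\mathbb{Z}_n^r$ its $\ast$-height $k^*=(k_1^*,\ldots,k_r^*)$ is defined recursively by $k_1^*=0$ and, for $j\ge 2$, $k_j^*=\min\{k_j,\ \max\{k_1^*+1,k_2^*+1,\ldots,k_{j-1}^*+1\}\}$. The set of $n$-restricted $q$-set partitions of $\{1,\ldots,r\}$ is $$\mathcal{P}_{n\times r}(q)=\{((k_1,a^{(1)}),\ldots,(k_r,a^{(r)}))\mid (k_1,\ldots,k_r)\in\mathbb{Z}_n^r,\ a^{(j)}\in\mathbb{F}_q^{\,k_j-k_j^*}\},$$ where $\mathbb{F}_q$ is the field with $q$ elements. -}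

module Defs where

open import Algebra.Apartness.Structures using (IsHeytingField)
open import Data.Bool.Properties as Bool using ()
open import Data.Fin.Base using (Fin; toℕ)
open import Data.Fin.Subset using (Subset; inside; outside; ⊤; ⋃; _∩_; Nonempty; Empty)
open import Data.Fin.Subset.Properties using (nonempty?)
open import Data.List.Base as List using (List; []; _∷_; _++_; length; filter; applyUpTo)
open import Data.List.Relation.Unary.All using (All; all?)
open import Data.List.Relation.Unary.AllPairs using (AllPairs; allPairs?)
open import Data.Nat.Base
open import Data.Nat.DivMod using (_/_)
open import Data.Nat.ListAction using (product)
open import Data.Nat.Primality using (Prime; prime⇒nonTrivial; prime⇒nonZero)
open import Data.Nat.Properties using (≤-trans; ^-monoʳ-≤; ≤-reflexive; *-identityʳ; m<n⇒0<n∸m)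
open import Data.Product.Base using (Σ; _×_)
open import Data.Vec.Base as Vec using (Vec; []; _∷_)
open import Data.Vec.Properties using (≡-dec)
import Data.Vec.Relation.Unary.All as VecAll
open import Function.Bundles using (_↔_)
open import Level using (Level) renaming (suc to lsuc)
open import Relation.Binary.PropositionalEquality using (_≡_; _≢_; sym; subst)
open import Relation.Nullary.Decidable using (Dec; ¬?; _×-dec_)

private
  variable
    c : Level

record PrimePower (q : ℕ) : Set where
  field
    p e  : ℕ
    p-prime : Prime p
    e≥1  : 1 ≤ e
    q≡p^e : q ≡ p ^ e

primePower⇒nonTrivial : ∀ {q} → PrimePower q → NonTrivial q
primePower⇒nonTrivial pp = n>1⇒nonTrivial
  (subst (1 <_) (sym q≡p^e)
    (≤-trans (nonTrivial⇒n>1 p {{prime⇒nonTrivial p-prime}})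
      (≤-trans (≤-reflexive (sym (*-identityʳ p)))
               (^-monoʳ-≤ p {{prime⇒nonZero p-prime}} e≥1))))
  where open PrimePower pp

-- With propositional equality and _≢_ as the apartness relation,
-- IsHeytingField is the usual notion of a field: a commutative ring in which
-- an element is invertible exactly when it is nonzero (so that 0 ≢ 1).
record FiniteField (c : Level) (q : ℕ) : Set (lsuc c) where
  infixl 7 _*F_
  infixl 6 _+F_
  field
    Carrier        : Set c
    _+F_ _*F_      : Carrier → Carrier → Carrier
    -F_            : Carrier → Carrier
    0F 1F          : Carrier
    isHeytingField : IsHeytingField _≡_ _≢_ _+F_ _*F_ -F_ 0F 1F
    cardinality    : Carrier ↔ Fin q

-- [ i ] = (qⁱ − 1) / (q − 1); both subtractions and the division are exact.
qNumber : (q : ℕ) .{{_ : NonTrivial q}} → ℕ → ℕ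
qNumber q i = _/_ (q ^ i ∸ 1) (q ∸ 1) {{>-nonZero (m<n⇒0<n∸m (nonTrivial⇒n>1 q))}}

-- [ n ] [ n − 1 ] ⋯ [ n − ℓ + 1 ], used only for ℓ ≤ n.
qFalling : (q : ℕ) .{{_ : NonTrivial q}} → ℕ → ℕ → ℕ
qFalling q n ℓ = product (applyUpTo (λ i → qNumber q (n ∸ i)) ℓ)

subsets : ∀ r → List (Subset r)
subsets zero    = [] ∷ []
subsets (suc r) = List.map (outside ∷_) (subsets r) ++ List.map (inside ∷_) (subsets r)

-- All sublists of length ℓ. On a duplicate-free list these represent the
-- ℓ-element sets of its entries, each exactly once.
choose : ∀ {a} {A : Set a} → ℕ → List A → List (List A)
choose zero    xs       = [] ∷ []
choose (suc ℓ) []       = []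
choose (suc ℓ) (x ∷ xs) = List.map (x ∷_) (choose ℓ xs) ++ choose (suc ℓ) xs

Disjoint : ∀ {r} → Subset r → Subset r → Set
Disjoint A B = Empty (A ∩ B)

IsSetPartition : ∀ {r} → List (Subset r) → Set
IsSetPartition bs = All Nonempty bs × AllPairs Disjoint bs × ⋃ bs ≡ ⊤

isSetPartition? : ∀ {r} (bs : List (Subset r)) → Dec (IsSetPartition bs)
isSetPartition? bs =
  all? nonempty? bs
    ×-dec allPairs? (λ A B → ¬? (nonempty? (A ∩ B))) bs
    ×-dec ≡-dec Bool._≟_ (⋃ bs) ⊤

-- S(r,ℓ): the number of ℓ-element sets of subsets of Fin r which form a
-- partition of Fin r into nonempty subsets.
stirling₂ : ℕ → ℕ → ℕ
stirling₂ r ℓ = length (filter isSetPartition? (choose ℓ (subsets r)))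

-- The argument m is max {k₁* + 1, …, k_{j−1}* + 1} over the entries already
-- processed.
heightsFrom : ∀ {r} → ℕ → Vec ℕ r → Vec ℕ r
heightsFrom m []       = []
heightsFrom m (k ∷ ks) = k ⊓ m ∷ heightsFrom (m ⊔ suc (k ⊓ m)) ks

-- The maximum over no entries is taken to be 0, which gives k₁* = k₁ ⊓ 0 = 0.
_⋆ : ∀ {r} → Vec ℕ r → Vec ℕ r
k ⋆ = heightsFrom 0 k

-- The pairs (k_j , a⁽ʲ⁾) are stored as the vector of all k_j together with a
-- heterogeneous vector whose j-th entry is a⁽ʲ⁾, a vector of length k_j − k_j*.
-- Since k_j* ≤ k_j, the truncated subtraction is exact.
RestrictedQPartition : ∀ {q} → FiniteField c q → (n r : ℕ) → Set c
RestrictedQPartition F n r =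
  Σ (Vec (Fin n) r) λ k →
    let ks = Vec.map toℕ k in
    VecAll.All (Vec (FiniteField.Carrier F)) (Vec.zipWith _∸_ ks (ks ⋆))

{-# OPTIONS --safe #-}
-- Once the ∗-heights of the processed entries are exactly 0, …, m − 1, a next entry k < m keeps
-- m and carries no vector, while k ≥ m raises m by one and carries q^(k−m) vectors.  The number
-- W m r of ways to fill r further positions thus satisfies
--   W m (r+1) = m W m r + [n−m] W (m+1) r,
-- and together with the Stirling recurrence this makes
--   Σ_ℓ S(s,ℓ) [n]⋯[n−ℓ+1] W ℓ r
-- depend on s + r only; the two extreme splittings are the two sides of the theorem.
--
-- For the Stirling recurrence, remove the point 0 from its block in a partition of r + 1 points.
-- Either nothing remains of that block, or a partition of r points with one marked block does.
module Submission where

open import Defs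
open import Algebra.Bundles using (CommutativeMonoid)
open import Data.Bool.Base using (if_then_else_)
open import Data.Fin.Base using (Fin; zero; suc; toℕ)
open import Data.Fin.Properties using (+↔⊎; *↔×)
open import Data.Fin.Subset using (Subset; inside; outside; ⊤; ⋃; _∪_; Nonempty; Empty)
open import Data.Fin.Subset.Properties using (nonempty?; drop-∷-Empty; Empty-unique; ∩-comm; ∩-idem; p∩q⊆p; ∪-identityˡ; ∪-commutativeMonoid)
open import Data.List.Base as List using (List; []; _∷_; _++_; [_]; applyUpTo; filter; length)
open import Data.List.Properties using (applyUpTo-∷ʳ; map-++; map-∘)
open import Data.List.Relation.Binary.Permutation.Propositional using (_↭_; ↭-sym; ↭⇒↭ₛ; prep; swap; refl)
open import Data.List.Relation.Binary.Permutation.Propositional.Properties using (All-resp-↭; shift; ++-comm)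
import Data.List.Relation.Binary.Permutation.Setoid.Properties as Permutationₛ
open import Data.List.Relation.Unary.All as All using (All; []; _∷_)
import Data.List.Relation.Unary.All.Properties as All
open import Data.List.Relation.Unary.AllPairs as AllPairs using (AllPairs; []; _∷_)
import Data.List.Relation.Unary.AllPairs.Properties as AllPairs
open import Data.Nat.Base
open import Data.Nat.DivMod using (_/_; m*n/n≡m)
open import Data.Nat.ListAction using (sum; product)
open import Data.Nat.ListAction.Properties using (sum-++; product-++)
open import Data.Nat.Properties
open import Data.Nat.Tactic.RingSolver using (solve-∀)
open import Data.Product.Base using (Σ; _×_; _,_)
open import Data.Product.Function.NonDependent.Propositional using (_×-↔_)
open import Data.Sum.Base using (_⊎_; inj₁; inj₂)
open import Data.Sum.Function.Propositional using (_⊎-↔_)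
open import Data.Vec.Base as Vec using (Vec; []; _∷_; here; there)
import Data.Vec.Relation.Unary.All as VecAll
open import Data.Vec.Relation.Unary.All using ([]; _∷_)
open import Function.Base using (_∘_)
open import Function.Bundles using (_↔_; _⇔_; mk↔ₛ′; mk⇔; Equivalence)
open import Function.Properties.Inverse using (↔-sym; ↔-trans)
open import Level using (Level)
open import Relation.Binary.PropositionalEquality hiding ([_])
open import Relation.Nullary.Decidable using (Dec; yes; no; does; does-⇔; dec-true; dec-false; ¬?)
open import Relation.Nullary.Negation using (¬_; contradiction)

open ≡-Reasoning

private
  variable
    a b : Level
    A : Set a
    B : Set b

-- Sums over lists and over initial segments of ℕ

∑ : List A → (A → ℕ) → ℕ
∑ xs f = sum (List.map f xs)

∑-cong : ∀ {f g : A → ℕ} → (∀ x → f x ≡ g x) → ∀ xs → ∑ xs f ≡ ∑ xs g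
∑-cong f≗g []       = refl
∑-cong f≗g (x ∷ xs) = cong₂ _+_ (f≗g x) (∑-cong f≗g xs)

∑-zero : ∀ (xs : List A) → ∑ xs (λ _ → 0) ≡ 0
∑-zero []       = refl
∑-zero (x ∷ xs) = ∑-zero xs

∑-++ : ∀ (f : A → ℕ) xs ys → ∑ (xs ++ ys) f ≡ ∑ xs f + ∑ ys f
∑-++ f xs ys = trans (cong sum (map-++ f xs ys)) (sum-++ (List.map f xs) (List.map f ys))

∑-map : ∀ (f : B → ℕ) (g : A → B) xs → ∑ (List.map g xs) f ≡ ∑ xs (f ∘ g)
∑-map f g xs = cong sum (sym (map-∘ xs))

interchange : ∀ a b c d → (a + b) + (c + d) ≡ (a + c) + (b + d)
interchange = solve-∀

∑-+ : ∀ (f g : A → ℕ) xs → ∑ xs (λ x → f x + g x) ≡ ∑ xs f + ∑ xs g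
∑-+ f g []       = refl
∑-+ f g (x ∷ xs) = trans (cong (f x + g x +_) (∑-+ f g xs)) (interchange (f x) (g x) (∑ xs f) (∑ xs g))

∑-*ʳ : ∀ (f : A → ℕ) c xs → ∑ xs (λ x → f x * c) ≡ ∑ xs f * c
∑-*ʳ f c []       = refl
∑-*ʳ f c (x ∷ xs) = trans (cong (f x * c +_) (∑-*ʳ f c xs)) (sym (*-distribʳ-+ c (f x) (∑ xs f)))

∑< : ℕ → (ℕ → ℕ) → ℕ
∑< n f = sum (applyUpTo f n)

∑<-cong : ∀ n {f g : ℕ → ℕ} → (∀ i → i < n → f i ≡ g i) → ∑< n f ≡ ∑< n g
∑<-cong zero    f≗g = refl
∑<-cong (suc n) f≗g = cong₂ _+_ (f≗g 0 z<s) (∑<-cong n (λ i i<n → f≗g (suc i) (s<s i<n)))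

∑<-+ : ∀ n (f g : ℕ → ℕ) → ∑< n (λ i → f i + g i) ≡ ∑< n f + ∑< n g
∑<-+ zero    f g = refl
∑<-+ (suc n) f g = trans (cong (f 0 + g 0 +_) (∑<-+ n (f ∘ suc) (g ∘ suc)))
                         (interchange (f 0) (g 0) (∑< n (f ∘ suc)) (∑< n (g ∘ suc)))

∑<-*ʳ : ∀ n (f : ℕ → ℕ) c → ∑< n (λ i → f i * c) ≡ ∑< n f * c
∑<-*ʳ zero    f c = refl
∑<-*ʳ (suc n) f c = trans (cong (f 0 * c +_) (∑<-*ʳ n (f ∘ suc) c)) (sym (*-distribʳ-+ c (f 0) (∑< n (f ∘ suc))))

∑<-const : ∀ n c → ∑< n (λ _ → c) ≡ n * c
∑<-const zero    c = refl
∑<-const (suc n) c = cong (c +_) (∑<-const n c)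

∑<-zero : ∀ n → ∑< n (λ _ → 0) ≡ 0
∑<-zero n = trans (∑<-const n 0) (*-zeroʳ n)

∑<-split : ∀ m d f → ∑< (m + d) f ≡ ∑< m f + ∑< d (λ i → f (m + i))
∑<-split zero    d f = refl
∑<-split (suc m) d f = trans (cong (f 0 +_) (∑<-split m d (f ∘ suc))) (sym (+-assoc (f 0) _ _))

∑<-last : ∀ n f → ∑< (suc n) f ≡ ∑< n f + f n
∑<-last zero    f = +-comm (f 0) 0
∑<-last (suc n) f = trans (cong (f 0 +_) (∑<-last n (f ∘ suc))) (sym (+-assoc (f 0) _ _))

-- Counting sublists

𝟙 : {P : Set a} → Dec P → ℕ
𝟙 P? = if does P? then 1 else 0

𝟙-cong : {P : Set a} {Q : Set b} → P ⇔ Q → (P? : Dec P) (Q? : Dec Q) → 𝟙 P? ≡ 𝟙 Q?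
𝟙-cong P⇔Q P? Q? = cong (if_then 1 else 0) (does-⇔ P⇔Q P? Q?)

𝟙-no : {P : Set a} (P? : Dec P) → ¬ P → 𝟙 P? ≡ 0
𝟙-no P? ¬p = cong (if_then 1 else 0) (dec-false P? ¬p)

𝟙-yes : {P : Set a} (P? : Dec P) → P → 𝟙 P? ≡ 1
𝟙-yes P? p = cong (if_then 1 else 0) (dec-true P? p)

length-filter-∑ : {P : A → Set b} (P? : ∀ x → Dec (P x)) → ∀ xs → length (filter P? xs) ≡ ∑ xs (𝟙 ∘ P?)
length-filter-∑ P? []       = refl
length-filter-∑ P? (x ∷ xs) with P? x
... | yes _ = cong suc (length-filter-∑ P? xs)
... | no  _ = length-filter-∑ P? xs

∑-choose-∷ : ∀ ℓ (x : A) xs (Q : List A → ℕ) →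
  ∑ (choose (suc ℓ) (x ∷ xs)) Q ≡ ∑ (choose ℓ xs) (Q ∘ (x ∷_)) + ∑ (choose (suc ℓ) xs) Q
∑-choose-∷ ℓ x xs Q = trans (∑-++ Q (List.map (x ∷_) (choose ℓ xs)) (choose (suc ℓ) xs))
  (cong (_+ _) (∑-map Q (x ∷_) (choose ℓ xs)))

-- Both sides count the (ℓ+1)-element sublists with a marked entry.
∑-choose-marked : ∀ ℓ (xs : List A) (Q : List A → ℕ) →
  (∀ {as bs} → as ↭ bs → Q as ≡ Q bs) → (∀ x as → Q (x ∷ x ∷ as) ≡ 0) →
  ∑ (choose ℓ xs) (λ as → ∑ xs (λ x → Q (x ∷ as))) ≡ suc ℓ * ∑ (choose (suc ℓ) xs) Q
∑-choose-marked zero    []       Q perm dup = refl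
∑-choose-marked (suc ℓ) []       Q perm dup = sym (*-zeroʳ (suc (suc ℓ)))
∑-choose-marked zero    (x ∷ xs) Q perm dup = begin
  Q [ x ] + ∑ xs (Q ∘ [_]) + 0             ≡⟨ +-assoc (Q [ x ]) _ 0 ⟩
  Q [ x ] + (∑ xs (Q ∘ [_]) + 0)           ≡⟨ cong (Q [ x ] +_) (∑-choose-marked 0 xs Q perm dup) ⟩
  Q [ x ] + 1 * ∑ (choose 1 xs) Q          ≡⟨ regroup (Q [ x ]) (∑ (choose 1 xs) Q) ⟩
  1 * (Q [ x ] + 0 + ∑ (choose 1 xs) Q)    ≡⟨ cong (1 *_) (∑-choose-∷ 0 x xs Q) ⟨
  1 * ∑ (choose 1 (x ∷ xs)) Q              ∎
  where
  regroup : ∀ u v → u + 1 * v ≡ 1 * (u + 0 + v)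
  regroup = solve-∀
∑-choose-marked {A = A} (suc ℓ) (x ∷ xs) Q perm dup = begin
  ∑ (choose (suc ℓ) (x ∷ xs)) (λ as → Q (x ∷ as) + R as)
    ≡⟨ ∑-choose-∷ ℓ x xs _ ⟩
  ∑ (choose ℓ xs) (λ as → Q (x ∷ x ∷ as) + R (x ∷ as)) + ∑ (choose (suc ℓ) xs) (λ as → Q (x ∷ as) + R as)
    -- Marking `x` in a list that already has `x` contributes 0 by `dup`. Any other mark `y` is
    -- moved behind `x`, so that the induction hypothesis applies to `Q ∘ (x ∷_)`.
    ≡⟨ cong₂ _+_ (∑-cong (λ as → cong₂ _+_ (dup x as) (∑-cong (λ y → perm (swap y x refl)) xs)) (choose ℓ xs))
                 (∑-+ (Q ∘ (x ∷_)) R (choose (suc ℓ) xs)) ⟩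
  ∑ (choose ℓ xs) (λ as → ∑ xs (λ y → Q (x ∷ y ∷ as))) + (u + ∑ (choose (suc ℓ) xs) R)
    ≡⟨ cong₂ (λ s t → s + (u + t))
         (∑-choose-marked ℓ xs (Q ∘ (x ∷_)) (λ p → perm (prep x p))
           (λ y as → trans (perm (↭-sym (shift x (y ∷ y ∷ []) as))) (dup y (x ∷ as))))
         (∑-choose-marked (suc ℓ) xs Q perm dup) ⟩
  -- Among the lists that contain `x`, `suc ℓ * u` comes from marking another entry and the single
  -- `u` from marking `x` itself.
  suc ℓ * u + (u + suc (suc ℓ) * v)
    ≡⟨ regroup ℓ u v ⟩
  suc (suc ℓ) * (u + v)
    ≡⟨ cong (suc (suc ℓ) *_) (∑-choose-∷ (suc ℓ) x xs Q) ⟨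
  suc (suc ℓ) * ∑ (choose (suc (suc ℓ)) (x ∷ xs)) Q ∎
  where
  R : List A → ℕ
  R as = ∑ xs (λ y → Q (y ∷ as))
  u v : ℕ
  u = ∑ (choose (suc ℓ) xs) (Q ∘ (x ∷_))
  v = ∑ (choose (suc (suc ℓ)) xs) Q
  regroup : ∀ ℓ u v → suc ℓ * u + (u + suc (suc ℓ) * v) ≡ suc (suc ℓ) * (u + v)
  regroup = solve-∀

-- A sublist with at least two entries starts with two `g`-images, so `two` applies to each summand.
-- This is the case of `∑-choose-++` where no `f`-images are left.
∑-choose-map-vanish : ∀ ℓ (g : A → B) ys (Q : List B → ℕ) → (∀ y y′ cs → Q (g y ∷ g y′ ∷ cs) ≡ 0) →
  ∑ (choose (suc (suc ℓ)) (List.map g ys)) Q ≡ 0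
∑-choose-map-vanish ℓ g []       Q two = refl
∑-choose-map-vanish ℓ g (y ∷ ys) Q two = trans (∑-choose-∷ (suc ℓ) (g y) (List.map g ys) Q)
  (cong₂ _+_ (heads ℓ ys) (∑-choose-map-vanish ℓ g ys Q two))
  where
  heads : ∀ ℓ zs → ∑ (choose (suc ℓ) (List.map g zs)) (Q ∘ (g y ∷_)) ≡ 0
  heads ℓ []       = refl
  heads ℓ (z ∷ zs) = trans (∑-choose-∷ ℓ (g z) (List.map g zs) _)
    (cong₂ _+_ (trans (∑-cong (two y z) (choose ℓ (List.map g zs))) (∑-zero (choose ℓ (List.map g zs)))) (heads ℓ zs))

∑-choose-1 : ∀ (xs : List A) (Q : List A → ℕ) → ∑ (choose 1 xs) Q ≡ ∑ xs (Q ∘ [_])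
∑-choose-1 []       Q = refl
∑-choose-1 (x ∷ xs) Q = cong (Q [ x ] +_) (∑-choose-1 xs Q)

-- A sublist of the concatenation consists of some `f`-images followed by some `g`-images. The
-- hypotheses kill the cases of no `g`-image and of at least two, so exactly one `g y` survives. For
-- partitions, the `g`-images are the subsets that contain the point 0.
∑-choose-++ : ∀ {c} {C : Set c} ℓ (f : A → C) (g : B → C) xs ys (Q : List C → ℕ) →
  (∀ as → Q (List.map f as) ≡ 0) → (∀ as y y′ cs → Q (List.map f as ++ g y ∷ g y′ ∷ cs) ≡ 0) →
  ∑ (choose (suc ℓ) (List.map f xs ++ List.map g ys)) Q
    ≡ ∑ (choose ℓ xs) (λ as → ∑ ys (λ y → Q (List.map f as ++ [ g y ])))
∑-choose-++ zero    f g []       ys Q none two = begin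
  ∑ (choose 1 (List.map g ys)) Q      ≡⟨ ∑-choose-1 (List.map g ys) Q ⟩
  ∑ (List.map g ys) (Q ∘ [_])         ≡⟨ ∑-map (Q ∘ [_]) g ys ⟩
  ∑ ys (λ y → Q [ g y ])              ≡⟨ +-identityʳ _ ⟨
  ∑ ys (λ y → Q [ g y ]) + 0          ∎
∑-choose-++ (suc ℓ) f g []       ys Q none two = ∑-choose-map-vanish ℓ g ys Q (two [])
∑-choose-++ zero    f g (x ∷ xs) ys Q none two =
  cong₂ _+_ (none (x ∷ [])) (∑-choose-++ zero f g xs ys Q none two)
∑-choose-++ (suc ℓ) f g (x ∷ xs) ys Q none two = begin
  ∑ (choose (suc (suc ℓ)) (f x ∷ zs)) Q
    ≡⟨ ∑-choose-∷ (suc ℓ) (f x) zs Q ⟩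
  ∑ (choose (suc ℓ) zs) (Q ∘ (f x ∷_)) + ∑ (choose (suc (suc ℓ)) zs) Q
    ≡⟨ cong₂ _+_ (∑-choose-++ ℓ f g xs ys (Q ∘ (f x ∷_)) (none ∘ (x ∷_)) (two ∘ (x ∷_)))
                 (∑-choose-++ (suc ℓ) f g xs ys Q none two) ⟩
  _ ≡⟨ ∑-choose-∷ ℓ x xs (λ as → ∑ ys (λ y → Q (List.map f as ++ [ g y ]))) ⟨
  ∑ (choose (suc ℓ) (x ∷ xs)) (λ as → ∑ ys (λ y → Q (List.map f as ++ [ g y ]))) ∎
  where zs = List.map f xs ++ List.map g ys

-- The Stirling recurrence

Disjoint-sym : ∀ {r} {A B : Subset r} → Disjoint A B → Disjoint B A
Disjoint-sym {A = A} {B} = subst Empty (∩-comm A B)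

-- Disjointness is symmetric and union is commutative, so the order of the blocks is immaterial.
-- This is needed because `choose` lists blocks in one fixed order, while marking a block moves it
-- to the front.
IsSetPartition-resp-↭ : ∀ {r} {as bs : List (Subset r)} → as ↭ bs → IsSetPartition as → IsSetPartition bs
IsSetPartition-resp-↭ {r} p (ne , dj , un) =
  All-resp-↭ p ne ,
  Permutationₛ.AllPairs-resp-↭ (setoid (Subset r)) (λ {A B} → Disjoint-sym {A = A} {B}) (subst (Disjoint _) , subst (λ A → Disjoint A _)) (↭⇒↭ₛ p) dj ,
  trans (sym (Permutationₛ.foldr-commMonoid (setoid (Subset r)) (CommutativeMonoid.isCommutativeMonoid (∪-commutativeMonoid r)) (↭⇒↭ₛ p))) un

partition# : ∀ {r} → List (Subset r) → ℕ
partition# bs = 𝟙 (isSetPartition? bs)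

partition#-resp-↭ : ∀ {r} {as bs : List (Subset r)} → as ↭ bs → partition# as ≡ partition# bs
partition#-resp-↭ p = 𝟙-cong (mk⇔ (IsSetPartition-resp-↭ p) (IsSetPartition-resp-↭ (↭-sym p))) (isSetPartition? _) (isSetPartition? _)

-- A nonempty block meets itself. This supplies the hypothesis `dup` of `∑-choose-marked`.
partition#-duplicate : ∀ {r} (b : Subset r) bs → partition# (b ∷ b ∷ bs) ≡ 0
partition#-duplicate b bs = 𝟙-no (isSetPartition? (b ∷ b ∷ bs))
  λ { (ne ∷ _ , (b∩b ∷ _) ∷ _ , _) → b∩b (subst Nonempty (sym (∩-idem b)) ne) }

⋃-map-outside : ∀ {r} (bs : List (Subset r)) → ⋃ (List.map (outside ∷_) bs) ≡ outside ∷ ⋃ bs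
⋃-map-outside []       = refl
⋃-map-outside (b ∷ bs) = cong ((outside ∷ b) ∪_) (⋃-map-outside bs)

-- The point 0 lies in no block. This supplies the hypothesis `none` of `∑-choose-++`.
partition#-uncovered : ∀ {r} (bs : List (Subset r)) → partition# (List.map (outside ∷_) bs) ≡ 0
partition#-uncovered bs = 𝟙-no (isSetPartition? (List.map (outside ∷_) bs))
  λ { (_ , _ , un) → contradiction (trans (sym (⋃-map-outside bs)) un) λ () }

-- The two displayed blocks share the point 0; a permutation brings them to the front. This supplies
-- the hypothesis `two` of `∑-choose-++`.
partition#-overlap : ∀ {r} as (b b′ : Subset r) cs →
  partition# (List.map (outside ∷_) as ++ (inside ∷ b) ∷ (inside ∷ b′) ∷ cs) ≡ 0
partition#-overlap as b b′ cs = trans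
  (partition#-resp-↭ (++-comm (List.map (outside ∷_) as) ((inside ∷ b) ∷ (inside ∷ b′) ∷ cs)))
  (𝟙-no (isSetPartition? ((inside ∷ b) ∷ (inside ∷ b′) ∷ cs ++ List.map (outside ∷_) as)) λ { (_ , (b∩b′ ∷ _) ∷ _ , _) → b∩b′ (zero , here) })

Nonempty-outside : ∀ {r} {b : Subset r} → Nonempty (outside ∷ b) ⇔ Nonempty b
Nonempty-outside = mk⇔ (λ { (suc x , there x∈b) → x , x∈b }) (λ { (x , x∈b) → suc x , there x∈b })

Empty-outside : ∀ {r} {b : Subset r} → Empty b → Empty (outside ∷ b)
Empty-outside ¬b ne = ¬b (Equivalence.to Nonempty-outside ne)

-- The other blocks avoid the point 0, so deleting it changes neither disjointness nor the covering
-- of the remaining points. Only the nonemptiness of the first block is lost, hence `b` itself may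
-- be empty on the right.
inside-∷-partition : ∀ {r} {b : Subset r} {as} →
  IsSetPartition ((inside ∷ b) ∷ List.map (outside ∷_) as)
    ⇔ (All Nonempty as × AllPairs Disjoint (b ∷ as) × ⋃ (b ∷ as) ≡ ⊤)
inside-∷-partition {b = b} {as} = mk⇔
  (λ { (_ ∷ ne , dj ∷ djs , un) →
    All.map (Equivalence.to Nonempty-outside) (All.map⁻ ne) ,
    All.map drop-∷-Empty (All.map⁻ dj) ∷ AllPairs.map drop-∷-Empty (AllPairs.map⁻ djs) ,
    cong Vec.tail (trans (sym ⋃-inside) un) })
  (λ { (ne , dj ∷ djs , un) →
    (zero , here) ∷ All.map⁺ (All.map (Equivalence.from Nonempty-outside) ne) ,
    All.map⁺ (All.map Empty-outside dj) ∷ AllPairs.map⁺ (AllPairs.map Empty-outside djs) ,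
    trans ⋃-inside (cong (inside ∷_) un) })
  where
  ⋃-inside : ⋃ ((inside ∷ b) ∷ List.map (outside ∷_) as) ≡ inside ∷ ⋃ (b ∷ as)
  ⋃-inside = cong ((inside ∷ b) ∪_) (⋃-map-outside as)

-- The first summand is the case where 0 was alone in its block, the second the case where a block
-- `b` remains. Each vanishes in the other's case, so the dichotomy becomes a sum that can be taken
-- over all `b`.
partition#-inside : ∀ {r} (as : List (Subset r)) b →
  partition# (List.map (outside ∷_) as ++ [ inside ∷ b ]) ≡ 𝟙 (¬? (nonempty? b)) * partition# as + partition# (b ∷ as)
partition#-inside as b = trans (partition#-resp-↭ (++-comm (List.map (outside ∷_) as) [ inside ∷ b ])) (cases (nonempty? b))
  where
  P# = partition# ((inside ∷ b) ∷ List.map (outside ∷_) as)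

  nonempty-case : Nonempty b → P# ≡ partition# (b ∷ as)
  nonempty-case ne = 𝟙-cong (mk⇔
    (λ p → let nes , djs , un = Equivalence.to inside-∷-partition p in ne ∷ nes , djs , un)
    (λ { (_ ∷ nes , djs , un) → Equivalence.from inside-∷-partition (nes , djs , un) }))
    (isSetPartition? _) (isSetPartition? (b ∷ as))

  empty-case : Empty b → P# ≡ partition# as
  empty-case ¬ne = 𝟙-cong (mk⇔ to from) (isSetPartition? _) (isSetPartition? as)
    where
    ⋃-empty : ⋃ (b ∷ as) ≡ ⋃ as
    ⋃-empty = trans (cong (_∪ ⋃ as) (Empty-unique ¬ne)) (∪-identityˡ (⋃ as))
    disjoint : ∀ c → Disjoint b c
    disjoint c (x , x∈b∩c) = ¬ne (x , p∩q⊆p b c x∈b∩c)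
    to : IsSetPartition ((inside ∷ b) ∷ List.map (outside ∷_) as) → IsSetPartition as
    to p with Equivalence.to inside-∷-partition p
    ... | nes , _ ∷ djs , un = nes , djs , trans (sym ⋃-empty) un
    from : IsSetPartition as → IsSetPartition ((inside ∷ b) ∷ List.map (outside ∷_) as)
    from (nes , djs , un) = Equivalence.from inside-∷-partition
      (nes , All.universal disjoint as ∷ djs , trans ⋃-empty un)

  cases : Dec (Nonempty b) → P# ≡ 𝟙 (¬? (nonempty? b)) * partition# as + partition# (b ∷ as)
  cases (yes ne) = begin
    P#                               ≡⟨ nonempty-case ne ⟩
    0 * partition# as + P′           ≡⟨ cong (λ t → t * partition# as + P′) (𝟙-no (¬? (nonempty? b)) (contradiction ne)) ⟨
    𝟙 (¬? (nonempty? b)) * partition# as + P′ ∎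
    where P′ = partition# (b ∷ as)
  cases (no ¬ne) = begin
    P#                               ≡⟨ empty-case ¬ne ⟩
    partition# as                    ≡⟨ trans (+-identityʳ _) (+-identityʳ _) ⟨
    1 * partition# as + 0            ≡⟨ cong₂ (λ t u → t * partition# as + u) (𝟙-yes (¬? (nonempty? b)) ¬ne)
                                          (𝟙-no (isSetPartition? (b ∷ as)) λ { (ne ∷ _ , _) → ¬ne ne }) ⟨
    𝟙 (¬? (nonempty? b)) * partition# as + partition# (b ∷ as) ∎

-- A subset containing 0 is not empty, so induction leaves only the subset that is `outside`
-- everywhere. Hence each partition of the remaining points is extended by a singleton block in
-- exactly one way.
∑-subsets-empty : ∀ r → ∑ (subsets r) (λ b → 𝟙 (¬? (nonempty? b))) ≡ 1
∑-subsets-empty zero    = refl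
∑-subsets-empty (suc r) = begin
  ∑ (subsets (suc r)) e
    ≡⟨ ∑-++ e (List.map (outside ∷_) (subsets r)) (List.map (inside ∷_) (subsets r)) ⟩
  ∑ (List.map (outside ∷_) (subsets r)) e + ∑ (List.map (inside ∷_) (subsets r)) e
    ≡⟨ cong₂ _+_ (∑-map e (outside ∷_) (subsets r)) (∑-map e (inside ∷_) (subsets r)) ⟩
  ∑ (subsets r) (e ∘ (outside ∷_)) + ∑ (subsets r) (e ∘ (inside ∷_))
    ≡⟨ cong₂ _+_
         (∑-cong (λ b → 𝟙-cong (mk⇔ drop-∷-Empty Empty-outside) (¬? (nonempty? (outside ∷ b))) (¬? (nonempty? b))) (subsets r))
         (∑-cong (λ b → 𝟙-no (¬? (nonempty? (inside ∷ b))) (λ ¬ne → ¬ne (zero , here))) (subsets r)) ⟩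
  ∑ (subsets r) (λ b → 𝟙 (¬? (nonempty? b))) + ∑ (subsets r) (λ _ → 0)
    ≡⟨ cong₂ _+_ (∑-subsets-empty r) (∑-zero (subsets r)) ⟩
  1 ∎
  where
  e : Subset (suc r) → ℕ
  e b = 𝟙 (¬? (nonempty? b))

stirling₂-∑ : ∀ r ℓ → stirling₂ r ℓ ≡ ∑ (choose ℓ (subsets r)) partition#
stirling₂-∑ r ℓ = length-filter-∑ isSetPartition? (choose ℓ (subsets r))

stirling₂-suc-zero : ∀ r → stirling₂ (suc r) 0 ≡ 0
stirling₂-suc-zero r = trans (stirling₂-∑ (suc r) 0) (trans (+-identityʳ _) (partition#-uncovered {r = r} []))

-- The only subset of the empty set is empty, so it cannot serve as a block, and two or more entries
-- cannot be chosen from a one-element list.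
stirling₂-zero-suc : ∀ ℓ → stirling₂ 0 (suc ℓ) ≡ 0
stirling₂-zero-suc zero    = refl
stirling₂-zero-suc (suc ℓ) = refl

stirling₂-suc-suc : ∀ r ℓ → stirling₂ (suc r) (suc ℓ) ≡ suc ℓ * stirling₂ r (suc ℓ) + stirling₂ r ℓ
stirling₂-suc-suc r ℓ = begin
  stirling₂ (suc r) (suc ℓ)
    ≡⟨ stirling₂-∑ (suc r) (suc ℓ) ⟩
  ∑ (choose (suc ℓ) (subsets (suc r))) partition#
    -- Exactly one block contains the point 0: `b` is what remains of it, and `as` are the other
    -- blocks.
    ≡⟨ ∑-choose-++ ℓ (outside ∷_) (inside ∷_) X X partition# partition#-uncovered partition#-overlap ⟩
  ∑ (choose ℓ X) (λ as → ∑ X (λ b → partition# (List.map (outside ∷_) as ++ [ inside ∷ b ])))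
    ≡⟨ ∑-cong pointwise (choose ℓ X) ⟩
  ∑ (choose ℓ X) (λ as → partition# as + ∑ X (λ b → partition# (b ∷ as)))
    ≡⟨ ∑-+ partition# _ (choose ℓ X) ⟩
  ∑ (choose ℓ X) partition# + ∑ (choose ℓ X) (λ as → ∑ X (λ b → partition# (b ∷ as)))
    -- The double sum counts the partitions into `suc ℓ` blocks with one marked block `b`, which
    -- gives the factor `suc ℓ`.
    ≡⟨ cong₂ _+_ (sym (stirling₂-∑ r ℓ)) (∑-choose-marked ℓ X partition# partition#-resp-↭ partition#-duplicate) ⟩
  stirling₂ r ℓ + suc ℓ * ∑ (choose (suc ℓ) X) partition#
    ≡⟨ cong (λ s → stirling₂ r ℓ + suc ℓ * s) (stirling₂-∑ r (suc ℓ)) ⟨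
  stirling₂ r ℓ + suc ℓ * stirling₂ r (suc ℓ)
    ≡⟨ +-comm (stirling₂ r ℓ) _ ⟩
  suc ℓ * stirling₂ r (suc ℓ) + stirling₂ r ℓ ∎
  where
  X = subsets r
  pointwise : ∀ as → ∑ X (λ b → partition# (List.map (outside ∷_) as ++ [ inside ∷ b ]))
                   ≡ partition# as + ∑ X (λ b → partition# (b ∷ as))
  pointwise as = begin
    ∑ X (λ b → partition# (List.map (outside ∷_) as ++ [ inside ∷ b ]))
      ≡⟨ ∑-cong (partition#-inside as) X ⟩
    ∑ X (λ b → 𝟙 (¬? (nonempty? b)) * partition# as + partition# (b ∷ as))
      ≡⟨ ∑-+ (λ b → 𝟙 (¬? (nonempty? b)) * partition# as) _ X ⟩
    ∑ X (λ b → 𝟙 (¬? (nonempty? b)) * partition# as) + ∑ X (λ b → partition# (b ∷ as))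
      ≡⟨ cong (_+ ∑ X (λ b → partition# (b ∷ as)))
           (trans (∑-*ʳ (λ b → 𝟙 (¬? (nonempty? b))) (partition# as) X)
             (trans (cong (_* partition# as) (∑-subsets-empty r)) (*-identityˡ _))) ⟩
    partition# as + ∑ X (λ b → partition# (b ∷ as)) ∎

-- q-numbers

-- The geometric sum, stated without subtraction in `geometric`. Writing `q` as `suc (suc p)` turns
-- the divisor `q ∸ 1` into `suc p`, so the division cancels. A sum of powers is the form in which
-- the counting below meets [i].
qNumber-∑ : ∀ q .{{_ : NonTrivial q}} i → qNumber q i ≡ ∑< i (q ^_)
qNumber-∑ q@(suc (suc p)) i = trans (cong (λ t → (t ∸ 1) / suc p) (geometric i)) (m*n/n≡m (∑< i (q ^_)) (suc p))
  where
  next : ∀ s p → suc (suc p) * suc (s * suc p) ≡ suc ((s + suc (s * suc p)) * suc p)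
  next = solve-∀
  geometric : ∀ i → q ^ i ≡ suc (∑< i (q ^_) * suc p)
  geometric zero    = refl
  geometric (suc i) = begin
    q * q ^ i                                    ≡⟨ cong (q *_) (geometric i) ⟩
    q * suc (s * suc p)                          ≡⟨ next s p ⟩
    suc ((s + suc (s * suc p)) * suc p)          ≡⟨ cong (λ t → suc ((s + t) * suc p)) (geometric i) ⟨
    suc ((s + q ^ i) * suc p)                    ≡⟨ cong (λ t → suc (t * suc p)) (∑<-last i (q ^_)) ⟨
    suc (∑< (suc i) (q ^_) * suc p)              ∎
    where s = ∑< i (q ^_)

qFalling-suc : ∀ q .{{_ : NonTrivial q}} n ℓ → qFalling q n (suc ℓ) ≡ qFalling q n ℓ * qNumber q (n ∸ ℓ)
qFalling-suc q n ℓ = begin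
  product (applyUpTo f (suc ℓ))           ≡⟨ cong product (applyUpTo-∷ʳ f ℓ) ⟨
  product (applyUpTo f ℓ ++ [ f ℓ ])      ≡⟨ product-++ (applyUpTo f ℓ) [ f ℓ ] ⟩
  product (applyUpTo f ℓ) * (f ℓ * 1)     ≡⟨ cong (product (applyUpTo f ℓ) *_) (*-identityʳ (f ℓ)) ⟩
  product (applyUpTo f ℓ) * f ℓ           ∎
  where
  f : ℕ → ℕ
  f i = qNumber q (n ∸ i)

-- The last factor is [0] = 0. This is why no state with more than `n` heights contributes and the
-- sums may stop at `n`.
qFalling-vanish : ∀ q .{{_ : NonTrivial q}} n → qFalling q n (suc n) ≡ 0
qFalling-vanish q n = begin
  qFalling q n (suc n)                    ≡⟨ qFalling-suc q n n ⟩
  qFalling q n n * qNumber q (n ∸ n)      ≡⟨ cong (λ d → qFalling q n n * qNumber q d) (n∸n≡0 n) ⟩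
  qFalling q n n * qNumber q 0            ≡⟨ cong (qFalling q n n *_) (qNumber-∑ q 0) ⟩
  qFalling q n n * 0                      ≡⟨ *-zeroʳ (qFalling q n n) ⟩
  0                                       ∎

-- Counting restricted q-set partitions

-- This is `W m r` of the overview, in the recursion of `heightsFrom`: the entry `k` receives the
-- height `k ⊓ m`, and the power of `q` counts its vectors.
extensions : (q n m r : ℕ) → ℕ
extensions q n m zero    = 1
extensions q n m (suc r) = ∑< n (λ k → q ^ (k ∸ k ⊓ m) * extensions q n (m ⊔ suc (k ⊓ m)) r)

extensions-suc : ∀ q .{{_ : NonTrivial q}} {n m} r → m ≤ n →
  extensions q n m (suc r) ≡ m * extensions q n m r + qNumber q (n ∸ m) * extensions q n (suc m) r
extensions-suc q {n} {m} r m≤n = begin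
  ∑< n F
    -- Since `m ≤ n`, the range of `k` can be cut at `m`. An entry below `m` is its own height; an
    -- entry `m + i` has height `m` and weight `q ^ i`, and these weights add up to [n - m].
    ≡⟨ cong (λ n → ∑< n F) (m+[n∸m]≡n m≤n) ⟨
  ∑< (m + (n ∸ m)) F
    ≡⟨ ∑<-split m (n ∸ m) F ⟩
  ∑< m F + ∑< (n ∸ m) (λ i → F (m + i))
    ≡⟨ cong₂ _+_ (∑<-cong m low) (∑<-cong (n ∸ m) (λ i _ → high i)) ⟩
  ∑< m (λ _ → extensions q n m r) + ∑< (n ∸ m) (λ i → q ^ i * extensions q n (suc m) r)
    ≡⟨ cong₂ _+_ (∑<-const m _) (∑<-*ʳ (n ∸ m) (q ^_) _) ⟩
  m * extensions q n m r + ∑< (n ∸ m) (q ^_) * extensions q n (suc m) r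
    ≡⟨ cong (λ t → m * extensions q n m r + t * extensions q n (suc m) r) (qNumber-∑ q (n ∸ m)) ⟨
  m * extensions q n m r + qNumber q (n ∸ m) * extensions q n (suc m) r ∎
  where
  F : ℕ → ℕ
  F k = q ^ (k ∸ k ⊓ m) * extensions q n (m ⊔ suc (k ⊓ m)) r
  low : ∀ k → k < m → F k ≡ extensions q n m r
  low k k<m rewrite m≤n⇒m⊓n≡m (<⇒≤ k<m) | n∸n≡0 k | m≥n⇒m⊔n≡m k<m = *-identityˡ _
  high : ∀ i → F (m + i) ≡ q ^ i * extensions q n (suc m) r
  high i rewrite m≥n⇒m⊓n≡n (m≤m+n m i) | m+n∸m≡n m i | m≤n⇒m⊔n≡n (n≤1+n m) = refl

-- The interpolating sum of the overview: `s` points are counted by Stirling numbers and `r` by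
-- extensions. The index starts at 0 because for `s = 0` the whole sum is its term at `ℓ = 0`.
mixedSum : (q : ℕ) .{{_ : NonTrivial q}} (n s r : ℕ) → ℕ
mixedSum q n s r = ∑< (suc n) (λ ℓ → stirling₂ s ℓ * qFalling q n ℓ * extensions q n ℓ r)

mixedSum-suc : ∀ q .{{_ : NonTrivial q}} n s r → mixedSum q n s (suc r) ≡ mixedSum q n (suc s) r
mixedSum-suc q n s r = begin
  ∑< (suc n) (λ ℓ → S ℓ * f ℓ * extensions q n ℓ (suc r))
    ≡⟨ ∑<-cong (suc n) expand ⟩
  ∑< (suc n) (λ ℓ → stay ℓ + move ℓ)
    -- `stay 0` is 0 by computation and `move n` contains the factor [0]. What is left pairs
    -- `stay (suc ℓ)` with `move ℓ`, which share `f (suc ℓ) * e (suc ℓ)` and combine by the Stirling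
    -- recurrence.
    ≡⟨ ∑<-+ (suc n) stay move ⟩
  ∑< n (stay ∘ suc) + ∑< (suc n) move
    ≡⟨ cong (∑< n (stay ∘ suc) +_) (trans (∑<-last n move) (trans (cong (∑< n move +_) move-last) (+-identityʳ _))) ⟩
  ∑< n (stay ∘ suc) + ∑< n move
    ≡⟨ ∑<-+ n (stay ∘ suc) move ⟨
  ∑< n (λ ℓ → stay (suc ℓ) + move ℓ)
    ≡⟨ ∑<-cong n (λ ℓ _ → collect ℓ) ⟩
  ∑< n (λ ℓ → stirling₂ (suc s) (suc ℓ) * f (suc ℓ) * e (suc ℓ))
    ≡⟨ cong (λ t → t * f 0 * e 0 + ∑< n (λ ℓ → stirling₂ (suc s) (suc ℓ) * f (suc ℓ) * e (suc ℓ))) (stirling₂-suc-zero s) ⟨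
  ∑< (suc n) (λ ℓ → stirling₂ (suc s) ℓ * f ℓ * e ℓ) ∎
  where
  S f e stay move : ℕ → ℕ
  S ℓ = stirling₂ s ℓ
  f ℓ = qFalling q n ℓ
  e ℓ = extensions q n ℓ r
  stay ℓ = ℓ * (S ℓ * f ℓ * e ℓ)
  move ℓ = S ℓ * f (suc ℓ) * e (suc ℓ)
  distribute : ∀ S f ℓ e c e′ → S * f * (ℓ * e + c * e′) ≡ ℓ * (S * f * e) + S * (f * c) * e′
  distribute = solve-∀
  factor : ∀ ℓ S′ f e S → ℓ * (S′ * f * e) + S * f * e ≡ (ℓ * S′ + S) * f * e
  factor = solve-∀
  expand : ∀ ℓ → ℓ < suc n → S ℓ * f ℓ * extensions q n ℓ (suc r) ≡ stay ℓ + move ℓ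
  expand ℓ ℓ<1+n = begin
    S ℓ * f ℓ * extensions q n ℓ (suc r)
      ≡⟨ cong (S ℓ * f ℓ *_) (extensions-suc q r (s≤s⁻¹ ℓ<1+n)) ⟩
    S ℓ * f ℓ * (ℓ * e ℓ + qNumber q (n ∸ ℓ) * e (suc ℓ))
      ≡⟨ distribute (S ℓ) (f ℓ) ℓ (e ℓ) (qNumber q (n ∸ ℓ)) (e (suc ℓ)) ⟩
    stay ℓ + S ℓ * (f ℓ * qNumber q (n ∸ ℓ)) * e (suc ℓ)
      ≡⟨ cong (λ t → stay ℓ + S ℓ * t * e (suc ℓ)) (qFalling-suc q n ℓ) ⟨
    stay ℓ + move ℓ ∎
  move-last : move n ≡ 0
  move-last = trans (cong (λ t → S n * t * e (suc n)) (qFalling-vanish q n))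
                    (cong (_* e (suc n)) (*-zeroʳ (S n)))
  collect : ∀ ℓ → stay (suc ℓ) + move ℓ ≡ stirling₂ (suc s) (suc ℓ) * f (suc ℓ) * e (suc ℓ)
  collect ℓ = trans (factor (suc ℓ) (S (suc ℓ)) (f (suc ℓ)) (e (suc ℓ)) (S ℓ))
    (cong (λ t → t * f (suc ℓ) * e (suc ℓ)) (sym (stirling₂-suc-suc s ℓ)))

mixedSum-exhaust : ∀ q .{{_ : NonTrivial q}} n s r → mixedSum q n s r ≡ mixedSum q n (r + s) 0
mixedSum-exhaust q n s zero    = refl
mixedSum-exhaust q n s (suc r) = trans (mixedSum-suc q n s r)
  (trans (mixedSum-exhaust q n (suc s) r) (cong (λ t → mixedSum q n t 0) (+-suc r s)))

extensions-stirling : ∀ q .{{_ : NonTrivial q}} n r →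
  extensions q n 0 (suc r) ≡ ∑< n (λ ℓ → stirling₂ (suc r) (suc ℓ) * qFalling q n (suc ℓ))
extensions-stirling q n r = begin
  extensions q n 0 (suc r)
    -- The factors `1 * 1` are S(0,0) and the empty product; all terms with `ℓ ≥ 1` vanish at
    -- `s = 0`.
    ≡⟨ trans (+-identityʳ _) (+-identityʳ _) ⟨
  1 * 1 * extensions q n 0 (suc r) + 0
    ≡⟨ cong (1 * 1 * extensions q n 0 (suc r) +_)
         (trans (∑<-cong n (λ ℓ _ → cong (λ t → t * qFalling q n (suc ℓ) * extensions q n (suc ℓ) (suc r)) (stirling₂-zero-suc ℓ))) (∑<-zero n)) ⟨
  mixedSum q n 0 (suc r)
    ≡⟨ trans (mixedSum-exhaust q n 0 (suc r)) (cong (λ t → mixedSum q n t 0) (+-identityʳ (suc r))) ⟩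
  mixedSum q n (suc r) 0
    -- The term at `ℓ = 0` drops out because S(r+1,0) = 0; this is where a nonempty ground set is
    -- needed.
    ≡⟨ cong (λ t → t * 1 * 1 + ∑< n (λ ℓ → stirling₂ (suc r) (suc ℓ) * qFalling q n (suc ℓ) * 1)) (stirling₂-suc-zero r) ⟩
  ∑< n (λ ℓ → stirling₂ (suc r) (suc ℓ) * qFalling q n (suc ℓ) * 1)
    ≡⟨ ∑<-cong n (λ ℓ _ → *-identityʳ _) ⟩
  ∑< n (λ ℓ → stirling₂ (suc r) (suc ℓ) * qFalling q n (suc ℓ)) ∎

-- The fibre sizes are a function on ℕ rather than on `Fin n`, so that they shift to `w ∘ suc` in
-- the induction and add up to `∑<`.
Σ-Fin↔ : ∀ n {B : Fin n → Set b} (w : ℕ → ℕ) → (∀ i → B i ↔ Fin (w (toℕ i))) → Σ (Fin n) B ↔ Fin (∑< n w)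
Σ-Fin↔ zero    w B↔ = mk↔ₛ′ (λ ()) (λ ()) (λ ()) (λ ())
Σ-Fin↔ (suc n) {B} w B↔ = ↔-trans split (↔-trans (B↔ zero ⊎-↔ Σ-Fin↔ n (w ∘ suc) (B↔ ∘ suc)) (↔-sym +↔⊎))
  where
  split : Σ (Fin (suc n)) B ↔ (B zero ⊎ Σ (Fin n) (B ∘ suc))
  split = mk↔ₛ′
    (λ { (zero , y) → inj₁ y ; (suc i , y) → inj₂ (i , y) })
    (λ { (inj₁ y) → zero , y ; (inj₂ (i , y)) → suc i , y })
    (λ { (inj₁ y) → refl ; (inj₂ (i , y)) → refl })
    (λ { (zero , y) → refl ; (suc i , y) → refl })

Vec↔Fin-^ : ∀ {q} → A ↔ Fin q → ∀ k → Vec A k ↔ Fin (q ^ k)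
Vec↔Fin-^ A↔ zero    = mk↔ₛ′ (λ _ → zero) (λ _ → []) (λ { zero → refl }) (λ { [] → refl })
Vec↔Fin-^ A↔ (suc k) = ↔-trans
  (mk↔ₛ′ (λ { (x ∷ xs) → x , xs }) (λ { (x , xs) → x ∷ xs }) (λ { (x , xs) → refl }) (λ { (x ∷ xs) → refl }))
  (↔-trans (A↔ ×-↔ Vec↔Fin-^ A↔ k) (↔-sym *↔×))

-- The entries still to come when m is the current bound max {k₁* + 1, …}.
Extension : Set a → (n m r : ℕ) → Set a
Extension C n m r = Σ (Vec (Fin n) r) λ k →
  VecAll.All (Vec C) (Vec.zipWith _∸_ (Vec.map toℕ k) (heightsFrom m (Vec.map toℕ k)))

-- Both sides recurse alike: the first entry `k` brings a vector of length `k ∸ k ⊓ m`, and the rest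
-- is an extension with the bound `m ⊔ suc (k ⊓ m)`.
Extension↔Fin : ∀ {q} → A ↔ Fin q → ∀ n m r → Extension A n m r ↔ Fin (extensions q n m r)
Extension↔Fin A↔ n m zero = mk↔ₛ′ (λ _ → zero) (λ _ → [] , []) (λ { zero → refl }) (λ { ([] , []) → refl })
Extension↔Fin {A = A} {q} A↔ n m (suc r) = ↔-trans uncons
  (Σ-Fin↔ n (λ k → q ^ (k ∸ k ⊓ m) * extensions q n (m ⊔ suc (k ⊓ m)) r)
    (λ k → ↔-trans (Vec↔Fin-^ A↔ _ ×-↔ Extension↔Fin A↔ n _ r) (↔-sym *↔×)))
  where
  uncons : Extension A n m (suc r) ↔
    Σ (Fin n) λ k → Vec A (toℕ k ∸ toℕ k ⊓ m) × Extension A n (m ⊔ suc (toℕ k ⊓ m)) r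
  uncons = mk↔ₛ′
    (λ { (k ∷ ks , v ∷ vs) → k , v , ks , vs })
    (λ { (k , v , ks , vs) → k ∷ ks , v ∷ vs })
    (λ { (k , v , ks , vs) → refl })
    (λ { (k ∷ ks , v ∷ vs) → refl })

mainTheorem2 : ∀ {c : Level} (q n r : ℕ) (q-pp : PrimePower q) (F : FiniteField c q) → 1 ≤ n → 1 ≤ r →
    RestrictedQPartition F n r ↔
    Fin (sum (applyUpTo (λ i → stirling₂ r (suc i) * qFalling q {{primePower⇒nonTrivial q-pp}} n (suc i)) n))
mainTheorem2 q n (suc r) q-pp F _ _ =
  -- As `_⋆` is `heightsFrom 0`, a restricted q-set partition is by definition an `Extension` with
  -- bound 0; only the cardinality has to be rewritten.
  subst (λ N → RestrictedQPartition F n (suc r) ↔ Fin N)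
    (extensions-stirling q {{primePower⇒nonTrivial q-pp}} n r)
    (Extension↔Fin (FiniteField.cardinality F) n 0 (suc r))
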